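{- For $3\le D\le 20000$ there is no graph of degree $11$, diameter $D$ and cyclic defect. Furthermore, for odd $g$ with $7\le g\le 40001$ there is no graph of degree $11$, girth $g$ and cyclic excess.
   Context: For an integer $d\ge 1$ define polynomials $G_{d,m}(x)$ by $G_{d,0}(x)=1$, $G_{d,1}(x)=x+1$, and $G_{d,m+1}(x)=xG_{d,m}(x)-(d-1)G_{d,m-1}(x)$ for $m\ge1$. Let $J_n$ be the $n\times n$ all-ones matrix. For a graph on $n\ge3$ vertices, a cycle matrix is the adjacency matrix $B$ of an $n$-cycle on the same vertex set (i.e., for some ordering $v_1,\dots,v_n$ of the vertices, $B_{ij}=1$ iff $v_i,v_j$ are cyclically consecutive, and $0$ otherwise); this cycle need not consist of edges of the graph. A graph $\Gamma$ of order $n$ with adjacency matrix $A$ is a graph of degree $d$, diameter $D$ and cyclic defect if $\Gamma$ is $d$-regular with $d\ge3$, has diameter $D\ge2$, and $G_{d,D}(A)=J_n+B$ for some cycle matrix $B$. It is a graph of degree $d$, girth $g$ and cyclic excess if $\Gamma$ is $d$-regular with $d\ge3$, has odd girth $g\ge5$, and $G_{d,\lfloor g/2\rfloor}(A)=J_n-B$ for some cycle matrix $B$. -}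

module Defs where

open import Data.Nat as ℕ using (ℕ; zero; suc; _≤_; _<_; _∸_; ⌊_/2⌋)
open import Data.Integer as ℤ using (ℤ; +_; -_)
open import Data.Fin using (Fin; toℕ)
import Data.Fin
import Relation.Nullary
open import Data.Bool using (Bool; true; false; if_then_else_)
open import Data.List using (List; []; _∷_)
open import Data.Product using (Σ; _×_; ∃; ∃-syntax; _,_)
open import Data.Sum using (_⊎_)
open import Function.Definitions using (Injective)
open import Relation.Binary.PropositionalEquality using (_≡_)
open import Relation.Nullary using (¬_)

record Graph (n : ℕ) : Set where
  field
    adj     : Fin n → Fin n → Bool
    adj-sym : ∀ u v → adj u v ≡ adj v u
    irrefl  : ∀ v → adj v v ≡ false
open Graph public

Adj : ∀ {n} → Graph n → Fin n → Fin n → Set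
Adj Γ u v = adj Γ u v ≡ true

sumℕ : ∀ {n} → (Fin n → ℕ) → ℕ
sumℕ {zero}  f = 0
sumℕ {suc n} f = f Data.Fin.zero ℕ.+ sumℕ (λ i → f (Data.Fin.suc i))

sumℤ : ∀ {n} → (Fin n → ℤ) → ℤ
sumℤ {zero}  f = + 0
sumℤ {suc n} f = f Data.Fin.zero ℤ.+ sumℤ (λ i → f (Data.Fin.suc i))

degree : ∀ {n} → Graph n → Fin n → ℕ
degree Γ v = sumℕ (λ w → if adj Γ v w then 1 else 0)

Regular : ∀ {n} → ℕ → Graph n → Set
Regular d Γ = ∀ v → degree Γ v ≡ d

data Walk {n} (Γ : Graph n) : ℕ → Fin n → Fin n → Set where
  nil  : ∀ {u} → Walk Γ 0 u u
  cons : ∀ {k u w v} → Adj Γ u w → Walk Γ k w v → Walk Γ (suc k) u v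

DistLe : ∀ {n} → Graph n → Fin n → Fin n → ℕ → Set
DistLe Γ u v k = ∃[ m ] (m ≤ k × Walk Γ m u v)

HasDiameter : ∀ {n} → Graph n → ℕ → Set
HasDiameter Γ D =
  (∀ u v → DistLe Γ u v D) ×
  (∃[ u ] ∃[ v ] (∀ m → Walk Γ m u v → D ≤ m))

CycSucc : ∀ {k} → Fin k → Fin k → Set
CycSucc {k} a b = (toℕ b ≡ suc (toℕ a)) ⊎ (suc (toℕ a) ≡ k × toℕ b ≡ 0)

HasCycle : ∀ {n} → Graph n → ℕ → Set
HasCycle {n} Γ k =
  3 ≤ k × Σ (Fin k → Fin n) (λ f →
    Injective _≡_ _≡_ f × (∀ a b → CycSucc a b → Adj Γ (f a) (f b)))

HasGirth : ∀ {n} → Graph n → ℕ → Set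
HasGirth Γ g = HasCycle Γ g × (∀ k → k < g → ¬ HasCycle Γ k)

Odd : ℕ → Set
Odd g = ∃[ k ] (g ≡ suc (2 ℕ.* k))

Mat : ℕ → Set
Mat n = Fin n → Fin n → ℤ

_≐_ : ∀ {n} → Mat n → Mat n → Set
M ≐ N = ∀ i j → M i j ≡ N i j

idM : ∀ {n} → Mat n
idM i j with i Data.Fin.≟ j
... | Relation.Nullary.yes _ = + 1
... | Relation.Nullary.no  _ = + 0

J : ∀ {n} → Mat n
J i j = + 1

zeroM : ∀ {n} → Mat n
zeroM i j = + 0

_+M_ _-M_ _*M_ : ∀ {n} → Mat n → Mat n → Mat n
(M +M N) i j = M i j ℤ.+ N i j
(M -M N) i j = M i j ℤ.- N i j
(M *M N) i j = sumℤ (λ k → M i k ℤ.* N k j)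

_·M_ : ∀ {n} → ℤ → Mat n → Mat n
(c ·M M) i j = c ℤ.* M i j

adjMatrix : ∀ {n} → Graph n → Mat n
adjMatrix Γ i j = if adj Γ i j then + 1 else + 0

IsCycleMatrix : ∀ {n} → Mat n → Set
IsCycleMatrix {n} B = 3 ≤ n × Σ (Fin n → Fin n) (λ v →
  Injective _≡_ _≡_ v ×
  (∀ a b → ((CycSucc a b ⊎ CycSucc b a) × B (v a) (v b) ≡ + 1)
         ⊎ (¬ (CycSucc a b ⊎ CycSucc b a) × B (v a) (v b) ≡ + 0)))

-- Integer polynomials as coefficient lists (constant term first)

Poly : Set
Poly = List ℤ

addP : Poly → Poly → Poly
addP []       q        = q
addP (a ∷ p)  []       = a ∷ p
addP (a ∷ p)  (b ∷ q)  = (a ℤ.+ b) ∷ addP p q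

scaleP : ℤ → Poly → Poly
scaleP c []      = []
scaleP c (a ∷ p) = (c ℤ.* a) ∷ scaleP c p

xP : Poly → Poly
xP p = + 0 ∷ p

G : ℕ → ℕ → Poly
G d zero          = + 1 ∷ []
G d (suc zero)    = + 1 ∷ + 1 ∷ []
G d (suc (suc m)) = addP (xP (G d (suc m))) (scaleP (- (+ (d ∸ 1))) (G d m))

evalMat : ∀ {n} → Poly → Mat n → Mat n
evalMat []      A = zeroM
evalMat (c ∷ p) A = (c ·M idM) +M (A *M evalMat p A)

CyclicDefect : ∀ {n} → ℕ → ℕ → Graph n → Set
CyclicDefect d D Γ =
  Regular d Γ × 3 ≤ d × HasDiameter Γ D × 2 ≤ D ×
  Σ (Mat _) (λ B → IsCycleMatrix B × (evalMat (G d D) (adjMatrix Γ) ≐ (J +M B)))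

CyclicExcess : ∀ {n} → ℕ → ℕ → Graph n → Set
CyclicExcess d g Γ =
  Regular d Γ × 3 ≤ d × Odd g × HasGirth Γ g × 5 ≤ g ×
  Σ (Mat _) (λ B → IsCycleMatrix B × (evalMat (G d ⌊ g /2⌋) (adjMatrix Γ) ≐ (J -M B)))

{-# OPTIONS --safe #-}
module Submission where

-- Let u be the vector alternating between 1 and -1 along the cycle of B.  The order n is
-- G(11) ∓ 2, which is even, so u is well defined and spans the -2-eigenspace of B.  Since A
-- commutes with B, u is an eigenvector of A; its eigenvalue θ is a sum of eleven signs, so
-- θ = 11 - 2q with 0 ≤ q ≤ 11, and comparing G(A) = J ± B on u gives G(θ) = ∓2.  For each of
-- the twelve values of θ, iterating the recurrence shows that G(θ) = ±2 never happens in the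
-- range 3 ≤ m ≤ 20000.  (It does for m = 2 and θ = 3.)

open import Defs
open import Data.Nat using (ℕ; _≤_)
open import Data.Product using (_×_)
open import Relation.Nullary using (¬_)
open import Data.Bool using (Bool; true; false; if_then_else_; not; _∧_)
open import Data.Bool.ListAction using (all)
open import Data.Bool.Properties using (∧-conicalʳ; T-≡)
open import Data.Fin using (Fin; zero; suc; toℕ; fromℕ<; punchIn; punchOut)
open import Data.Fin.Properties using
  (_≟_; any?; injective⇒≤; punchInᵢ≢i; punchIn-injective; punchIn-punchOut; punchOut-injective;
   toℕ-injective; toℕ-fromℕ<; toℕ<n)
open import Data.Integer using (ℤ; +_; -_; _+_; _-_; _*_; ∣_∣; 0ℤ; 1ℤ; -1ℤ)
open import Data.Integer.Properties hiding (_≟_)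
open import Data.Integer.Divisibility.Signed as Signed using (divides; ∣⇒∣ᵤ)
open import Data.Integer.Tactic.RingSolver using (solve-∀)
open import Data.List using ([]; _∷_; upTo)
open import Data.List.Membership.Propositional.Properties using (∈-upTo⁺)
import Data.List.Relation.Unary.All as All
open import Data.List.Relation.Unary.All.Properties using (all⁺)
open import Data.Nat as ℕ using (zero; suc; _∸_; z≤n; s≤s)
open import Data.Nat.Divisibility using (_∣_; quotient; m∣n⇒n≡quotient*m)
open import Data.Nat.DivMod using
  (_%_; _/_; _mod_; m≡m%n+[m/n]*n; [m+n]%n≡m%n; [m+kn]%n≡m%n; m<n⇒m%n≡m; m%n<n; n%n≡0)
import Data.Nat.Properties as ℕ
open import Data.Product using (_,_; ∃-syntax; proj₁; proj₂)
open import Data.Sum using (_⊎_; inj₁; inj₂; [_,_]′; swap; map)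
open import Data.Vec.Functional using (Vector; removeAt)
open import Function.Base using (_∘_; id)
open import Function.Bundles using (Equivalence)
open import Function.Definitions using (Injective)
open import Relation.Binary.PropositionalEquality
open import Relation.Nullary using (yes; no; contradiction)
open import Algebra.Properties.AbelianGroup +-0-abelianGroup using (∙-cancelʳ)
open import Algebra.Properties.Semiring.Sum +-*-semiring
  using (sum; sum-cong-≗; sum-replicate-zero; ∑-distrib-+; ∑-comm;
         *-distribˡ-sum; *-distribʳ-sum; sum-remove)
open ≡-Reasoning

private
  variable
    n : ℕ

-- Finite sums of integers.

sumℤ≡sum : (f : Vector ℤ n) → sumℤ f ≡ sum f
sumℤ≡sum {zero}  f = refl
sumℤ≡sum {suc n} f = cong (_+_ (f zero)) (sumℤ≡sum (f ∘ suc))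

sum-zero : (f : Vector ℤ n) → (∀ j → f j ≡ 0ℤ) → sum f ≡ 0ℤ
sum-zero {n} f f≡0 = trans (sum-cong-≗ f≡0) (sum-replicate-zero n)

sum-singleton : (f : Vector ℤ n) (i : Fin n) → (∀ j → j ≢ i → f j ≡ 0ℤ) → sum f ≡ f i
sum-singleton {suc n} f i f≡0 = begin
  sum f                      ≡⟨ sum-remove f ⟩
  f i + sum (removeAt f i)   ≡⟨ cong (_+_ (f i)) (sum-zero _ λ j → f≡0 _ (punchInᵢ≢i i j)) ⟩
  f i + 0ℤ                   ≡⟨ +-identityʳ (f i) ⟩
  f i                        ∎

-- Meant for the rows of a cycle matrix, whose nonzero entries sit at two distinct places.
sum-pair : (f : Vector ℤ n) {p q : Fin n} → p ≢ q →
           (∀ j → j ≢ p → j ≢ q → f j ≡ 0ℤ) → sum f ≡ f p + f q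
sum-pair {suc n} f {p} {q} p≢q f≡0 = begin
  sum f                       ≡⟨ sum-remove f ⟩
  f p + sum (removeAt f p)    ≡⟨ cong (_+_ (f p)) (sum-singleton (removeAt f p) (punchOut p≢q) rest) ⟩
  f p + f (punchIn p (punchOut p≢q)) ≡⟨ cong (λ j → f p + f j) (punchIn-punchOut p≢q) ⟩
  f p + f q                   ∎
  where
  rest : ∀ j → j ≢ punchOut p≢q → f (punchIn p j) ≡ 0ℤ
  rest j j≢ = f≡0 _ (punchInᵢ≢i p j) λ eq →
    j≢ (punchIn-injective p _ _ (trans eq (sym (punchIn-punchOut p≢q))))

sum-const : ∀ n c → sum {n} (λ _ → c) ≡ + n * c
sum-const zero    c = sym (*-zeroˡ c)
sum-const (suc n) c = trans (cong (_+_ c) (sum-const n c)) (sym (suc-* (+ n) c))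

-- Matrices acting on vectors.

infixr 7 _*V_

_*V_ : Mat n → Vector ℤ n → Vector ℤ n
(M *V x) i = sum (λ j → M i j * x j)

𝟙 : Vector ℤ n
𝟙 _ = 1ℤ

*V-cong : (M : Mat n) {x y : Vector ℤ n} → x ≗ y → M *V x ≗ M *V y
*V-cong M x≗y i = sum-cong-≗ λ j → cong (M i j *_) (x≗y j)

*V-scale : (M : Mat n) (c : ℤ) (x : Vector ℤ n) → ∀ i → (M *V (λ j → c * x j)) i ≡ c * (M *V x) i
*V-scale M c x i = begin
  sum (λ j → M i j * (c * x j))   ≡⟨ sum-cong-≗ (λ j → swap-* (M i j) c (x j)) ⟩
  sum (λ j → c * (M i j * x j))   ≡⟨ *-distribˡ-sum c (λ j → M i j * x j) ⟨
  c * (M *V x) i                  ∎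
  where
  swap-* : ∀ a b z → a * (b * z) ≡ b * (a * z)
  swap-* = solve-∀

*V-+ : (M : Mat n) (x y : Vector ℤ n) → ∀ i → (M *V (λ j → x j + y j)) i ≡ (M *V x) i + (M *V y) i
*V-+ M x y i = trans (sum-cong-≗ λ j → *-distribˡ-+ (M i j) (x j) (y j))
                     (∑-distrib-+ (λ j → M i j * x j) (λ j → M i j * y j))

idM-*V : (x : Vector ℤ n) → idM *V x ≗ x
idM-*V x i = trans (sum-singleton _ i off) diag
  where
  off : ∀ j → j ≢ i → idM i j * x j ≡ 0ℤ
  off j j≢i with i ≟ j
  ... | yes refl = contradiction refl j≢i
  ... | no  _    = *-zeroˡ (x j)
  diag : idM i i * x i ≡ x i
  diag with i ≟ i
  ... | yes _  = *-identityˡ (x i)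
  ... | no i≢i = contradiction refl i≢i

*M-*V : (M N : Mat n) (x : Vector ℤ n) → (M *M N) *V x ≗ M *V N *V x
*M-*V M N x i = begin
  sum (λ j → sumℤ (λ k → M i k * N k j) * x j)      ≡⟨ sum-cong-≗ inner ⟩
  sum (λ j → sum (λ k → M i k * (N k j * x j)))     ≡⟨ ∑-comm (λ j k → M i k * (N k j * x j)) ⟩
  sum (λ k → sum (λ j → M i k * (N k j * x j)))     ≡⟨ sum-cong-≗ (λ k → *-distribˡ-sum (M i k) (λ j → N k j * x j)) ⟨
  (M *V N *V x) i                                   ∎
  where
  inner : ∀ j → sumℤ (λ k → M i k * N k j) * x j ≡ sum (λ k → M i k * (N k j * x j))
  inner j = begin
    sumℤ (λ k → M i k * N k j) * x j      ≡⟨ cong (_* x j) (sumℤ≡sum (λ k → M i k * N k j)) ⟩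
    sum (λ k → M i k * N k j) * x j       ≡⟨ *-distribʳ-sum (x j) (λ k → M i k * N k j) ⟩
    sum (λ k → M i k * N k j * x j)       ≡⟨ sum-cong-≗ (λ k → *-assoc (M i k) (N k j) (x j)) ⟩
    sum (λ k → M i k * (N k j * x j))     ∎

-- Matrix polynomials and their values at an eigenvalue.

evalMat-[] : (A : Mat n) (x : Vector ℤ n) → ∀ i → (evalMat [] A *V x) i ≡ 0ℤ
evalMat-[] A x i = sum-zero _ λ j → *-zeroˡ (x j)

evalMat-∷ : ∀ c p (A : Mat n) (x : Vector ℤ n) → ∀ i →
            (evalMat (c ∷ p) A *V x) i ≡ c * x i + (A *V evalMat p A *V x) i
evalMat-∷ c p A x i = begin
  sum (λ j → (c * idM i j + (A *M P) i j) * x j)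
    ≡⟨ sum-cong-≗ (λ j → expand c (idM i j) ((A *M P) i j) (x j)) ⟩
  sum (λ j → c * (idM i j * x j) + (A *M P) i j * x j)
    ≡⟨ ∑-distrib-+ (λ j → c * (idM i j * x j)) (λ j → (A *M P) i j * x j) ⟩
  sum (λ j → c * (idM i j * x j)) + ((A *M P) *V x) i
    ≡⟨ cong₂ _+_ (trans (sym (*-distribˡ-sum c (λ j → idM i j * x j))) (cong (c *_) (idM-*V x i))) (*M-*V A P x i) ⟩
  c * x i + (A *V P *V x) i ∎
  where
  P = evalMat p A
  expand : ∀ c d e y → (c * d + e) * y ≡ c * (d * y) + e * y
  expand = solve-∀

-- The Horner form of `evalMat` multiplies by `A` on the left only. By induction on `p`, linearity
-- of `A` lets the inner factor be pulled to the outside. Working on vectors avoids commuting matrix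
-- products.
evalMat-comm : ∀ p (A : Mat n) (x : Vector ℤ n) → evalMat p A *V A *V x ≗ A *V evalMat p A *V x
evalMat-comm []      A x i = trans (evalMat-[] A (A *V x) i) (sym (sum-zero _ λ j →
  trans (cong (A i j *_) (evalMat-[] A x j)) (*-zeroʳ (A i j))))
evalMat-comm (c ∷ p) A x i = begin
  (evalMat (c ∷ p) A *V A *V x) i
    ≡⟨ evalMat-∷ c p A (A *V x) i ⟩
  c * (A *V x) i + (A *V P *V A *V x) i
    ≡⟨ cong₂ _+_ (sym (*V-scale A c x i)) (*V-cong A (evalMat-comm p A x) i) ⟩
  (A *V (λ j → c * x j)) i + (A *V A *V P *V x) i
    ≡⟨ *V-+ A _ _ i ⟨
  (A *V (λ j → c * x j + (A *V P *V x) j)) i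
    ≡⟨ *V-cong A (evalMat-∷ c p A x) i ⟨
  (A *V evalMat (c ∷ p) A *V x) i ∎
  where P = evalMat p A

evalP : Poly → ℤ → ℤ
evalP []      μ = 0ℤ
evalP (c ∷ p) μ = c + μ * evalP p μ

evalMat-eigen : ∀ p (A : Mat n) (x : Vector ℤ n) μ → (∀ i → (A *V x) i ≡ μ * x i) →
                ∀ i → (evalMat p A *V x) i ≡ evalP p μ * x i
evalMat-eigen []      A x μ Ax≡μx i = trans (evalMat-[] A x i) (sym (*-zeroˡ (x i)))
evalMat-eigen (c ∷ p) A x μ Ax≡μx i = begin
  (evalMat (c ∷ p) A *V x) i
    ≡⟨ evalMat-∷ c p A x i ⟩
  c * x i + (A *V evalMat p A *V x) i
    ≡⟨ cong (_+_ (c * x i)) (*V-cong A (evalMat-eigen p A x μ Ax≡μx) i) ⟩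
  c * x i + (A *V (λ j → evalP p μ * x j)) i
    ≡⟨ cong (_+_ (c * x i)) (*V-scale A (evalP p μ) x i) ⟩
  c * x i + evalP p μ * (A *V x) i
    ≡⟨ cong (λ y → c * x i + evalP p μ * y) (Ax≡μx i) ⟩
  c * x i + evalP p μ * (μ * x i)
    ≡⟨ collect c (evalP p μ) μ (x i) ⟩
  evalP (c ∷ p) μ * x i ∎
  where
  collect : ∀ c e m y → c * y + e * (m * y) ≡ (c + m * e) * y
  collect = solve-∀

evalP-addP : ∀ p q μ → evalP (addP p q) μ ≡ evalP p μ + evalP q μ
evalP-addP []      q       μ = sym (+-identityˡ _)
evalP-addP (a ∷ p) []      μ = sym (+-identityʳ _)
evalP-addP (a ∷ p) (b ∷ q) μ = begin
  a + b + μ * evalP (addP p q) μ          ≡⟨ cong (λ e → a + b + μ * e) (evalP-addP p q μ) ⟩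
  a + b + μ * (evalP p μ + evalP q μ)     ≡⟨ regroup a b μ (evalP p μ) (evalP q μ) ⟩
  (a + μ * evalP p μ) + (b + μ * evalP q μ) ∎
  where
  regroup : ∀ a b m e f → a + b + m * (e + f) ≡ (a + m * e) + (b + m * f)
  regroup = solve-∀

evalP-scaleP : ∀ c p μ → evalP (scaleP c p) μ ≡ c * evalP p μ
evalP-scaleP c []      μ = sym (*-zeroʳ c)
evalP-scaleP c (a ∷ p) μ = begin
  c * a + μ * evalP (scaleP c p) μ   ≡⟨ cong (λ e → c * a + μ * e) (evalP-scaleP c p μ) ⟩
  c * a + μ * (c * evalP p μ)        ≡⟨ regroup c a μ (evalP p μ) ⟩
  c * (a + μ * evalP p μ)            ∎
  where
  regroup : ∀ c a m e → c * a + m * (c * e) ≡ c * (a + m * e)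
  regroup = solve-∀

evalP-G : ∀ d m μ → evalP (G d (2 ℕ.+ m)) μ ≡
          μ * evalP (G d (1 ℕ.+ m)) μ - + (d ∸ 1) * evalP (G d m) μ
evalP-G d m μ = begin
  evalP (addP (xP (G d (suc m))) (scaleP (- + (d ∸ 1)) (G d m))) μ
    ≡⟨ evalP-addP (xP (G d (suc m))) (scaleP (- + (d ∸ 1)) (G d m)) μ ⟩
  0ℤ + μ * evalP (G d (suc m)) μ + evalP (scaleP (- + (d ∸ 1)) (G d m)) μ
    ≡⟨ cong₂ _+_ (+-identityˡ (μ * evalP (G d (suc m)) μ)) (evalP-scaleP (- + (d ∸ 1)) (G d m) μ) ⟩
  μ * evalP (G d (suc m)) μ + (- + (d ∸ 1)) * evalP (G d m) μ
    ≡⟨ cong (_+_ (μ * evalP (G d (suc m)) μ)) (neg-distribˡ-* (+ (d ∸ 1)) (evalP (G d m) μ)) ⟨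
  μ * evalP (G d (suc m)) μ - + (d ∸ 1) * evalP (G d m) μ ∎

-- Cyclic successors as steps modulo `n`.

toℕ-mod : ∀ k n .{{_ : ℕ.NonZero n}} → toℕ (k mod n) ≡ k % n
toℕ-mod k n = toℕ-fromℕ< (m%n<n k n)

toℕ-mod-id : ∀ {n} .{{_ : ℕ.NonZero n}} (i : Fin n) → toℕ i mod n ≡ i
toℕ-mod-id {n} i = toℕ-injective (trans (toℕ-mod (toℕ i) n) (m<n⇒m%n≡m (toℕ<n i)))

suc-% : ∀ k n .{{_ : ℕ.NonZero n}} → suc k % n ≡ suc (k % n) % n
suc-% k n = trans (cong (λ m → suc m % n) (m≡m%n+[m/n]*n k n)) ([m+kn]%n≡m%n (suc (k % n)) (k / n) n)

-- The two cases of `CycSucc` correspond to whether `k` has the last residue, from which the next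
-- step wraps round to 0.
CycSucc-mod : ∀ k n .{{_ : ℕ.NonZero n}} → CycSucc (k mod n) (suc k mod n)
CycSucc-mod k n with suc (k % n) ℕ.≟ n
... | yes 1+r≡n = inj₂ (trans (cong suc (toℕ-mod k n)) 1+r≡n , (begin
  toℕ (suc k mod n)   ≡⟨ toℕ-mod (suc k) n ⟩
  suc k % n           ≡⟨ suc-% k n ⟩
  suc (k % n) % n     ≡⟨ cong (_% n) 1+r≡n ⟩
  n % n               ≡⟨ n%n≡0 n ⟩
  0                   ∎))
... | no  1+r≢n = inj₁ (begin
  toℕ (suc k mod n)   ≡⟨ toℕ-mod (suc k) n ⟩
  suc k % n           ≡⟨ suc-% k n ⟩
  suc (k % n) % n     ≡⟨ m<n⇒m%n≡m (ℕ.≤∧≢⇒< (m%n<n k n) 1+r≢n) ⟩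
  suc (k % n)         ≡⟨ cong suc (toℕ-mod k n) ⟨
  suc (toℕ (k mod n)) ∎)

CycSucc-functional : {a b c : Fin n} → CycSucc a b → CycSucc a c → b ≡ c
CycSucc-functional         (inj₁ p)       (inj₁ q)       = toℕ-injective (trans p (sym q))
CycSucc-functional {b = b} (inj₁ p)       (inj₂ (q , _)) = contradiction (trans p q) (ℕ.<⇒≢ (toℕ<n b))
CycSucc-functional {c = c} (inj₂ (p , _)) (inj₁ q)       = contradiction (trans q p) (ℕ.<⇒≢ (toℕ<n c))
CycSucc-functional         (inj₂ (_ , p)) (inj₂ (_ , q)) = toℕ-injective (trans p (sym q))

CycSucc-injective : {a b c : Fin n} → CycSucc a c → CycSucc b c → a ≡ b
CycSucc-injective (inj₁ p)       (inj₁ q)       = toℕ-injective (ℕ.suc-injective (trans (sym p) q))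
CycSucc-injective (inj₁ p)       (inj₂ (_ , q)) = contradiction (trans (sym p) q) λ()
CycSucc-injective (inj₂ (_ , p)) (inj₁ q)       = contradiction (trans (sym q) p) λ()
CycSucc-injective (inj₂ (p , _)) (inj₂ (q , _)) = toℕ-injective (ℕ.suc-injective (trans p (sym q)))

-- Two ordinary steps raise the position by two, one ordinary step and one wrap force `n` to be 2,
-- and two wraps force it to be 1. This keeps the two neighbours of a vertex on the cycle distinct.
CycSucc-asym : 3 ≤ n → {a b : Fin n} → CycSucc a b → ¬ CycSucc b a
CycSucc-asym 3≤n {a} (inj₁ p) (inj₁ q) =
  contradiction (trans q (cong suc p)) (ℕ.<⇒≢ (ℕ.m<n⇒m<1+n (ℕ.n<1+n (toℕ a))))
CycSucc-asym 3≤n (inj₁ p) (inj₂ (q , r)) =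
  contradiction (trans (cong (2 ℕ.+_) (sym r)) (trans (cong suc (sym p)) q)) (ℕ.<⇒≢ 3≤n)
CycSucc-asym 3≤n (inj₂ (p , r)) (inj₁ q) =
  contradiction (trans (cong (2 ℕ.+_) (sym r)) (trans (cong suc (sym q)) p)) (ℕ.<⇒≢ 3≤n)
CycSucc-asym 3≤n (inj₂ (_ , r)) (inj₂ (p , _)) =
  contradiction (trans (cong suc (sym r)) p) (ℕ.<⇒≢ (ℕ.≤-trans (s≤s (s≤s z≤n)) 3≤n))

-- If `j` were missed, punching it out of the codomain would inject `suc n` elements into `n`.
injective⇒surjective : (f : Fin n → Fin n) → Injective _≡_ _≡_ f → ∀ j → ∃[ i ] f i ≡ j
injective⇒surjective {suc n} f f-inj j with any? (λ i → f i ≟ j)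
... | yes hit  = hit
... | no  miss = contradiction
  (injective⇒≤ {f = λ i → punchOut (j≢f i)} λ eq → f-inj (punchOut-injective (j≢f _) (j≢f _) eq))
  ℕ.1+n≰n
  where
  j≢f : ∀ i → j ≢ f i
  j≢f i j≡fi = miss (i , sym j≡fi)

-- A sequence with f k + f (k + 2) = 2 f (k + 1) is an arithmetic progression, and a
-- progression that returns to its initial value is constant.
midpoint-closed⇒constant : (f : ℕ → ℤ) → (∀ k → f k + f (2 ℕ.+ k) ≡ + 2 * f (1 ℕ.+ k)) →
                           ∀ n .{{_ : ℕ.NonZero n}} → f n ≡ f 0 → ∀ k → f k ≡ f 0
midpoint-closed⇒constant f mid n@(suc _) fn≡f0 k = begin
  f k               ≡⟨ progression k ⟩
  f 0 + + k * δ     ≡⟨ cong (λ e → f 0 + + k * e) δ≡0 ⟩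
  f 0 + + k * 0ℤ    ≡⟨ cong (_+_ (f 0)) (*-zeroʳ (+ k)) ⟩
  f 0 + 0ℤ          ≡⟨ +-identityʳ (f 0) ⟩
  f 0               ∎
  where
  δ = f 1 - f 0

  step : ∀ k → f (suc k) - f k ≡ δ
  step zero    = refl
  step (suc k) = begin
    f (2 ℕ.+ k) - f (suc k)                    ≡⟨ shift (f k) (f (suc k)) (f (2 ℕ.+ k)) ⟩
    (f k + f (2 ℕ.+ k)) - f k - f (suc k)      ≡⟨ cong (λ e → e - f k - f (suc k)) (mid k) ⟩
    + 2 * f (suc k) - f k - f (suc k)          ≡⟨ halve (f k) (f (suc k)) ⟩
    f (suc k) - f k                            ≡⟨ step k ⟩
    δ                                          ∎
    where
    shift : ∀ x y z → z - y ≡ (x + z) - x - y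
    shift = solve-∀
    halve : ∀ x y → + 2 * y - x - y ≡ y - x
    halve = solve-∀

  progression : ∀ k → f k ≡ f 0 + + k * δ
  progression zero    = sym (trans (cong (_+_ (f 0)) (*-zeroˡ δ)) (+-identityʳ (f 0)))
  progression (suc k) = begin
    f (suc k)                    ≡⟨ split (f k) (f (suc k)) ⟩
    f k + (f (suc k) - f k)      ≡⟨ cong₂ _+_ (progression k) (step k) ⟩
    f 0 + + k * δ + δ            ≡⟨ collect (f 0) (+ k) δ ⟩
    f 0 + (1ℤ + + k) * δ         ∎
    where
    split : ∀ x y → y ≡ x + (y - x)
    split = solve-∀
    collect : ∀ x c e → x + c * e + e ≡ x + (1ℤ + c) * e
    collect = solve-∀

  nδ≡0 : + n * δ ≡ 0ℤ
  nδ≡0 = begin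
    + n * δ                ≡⟨ cancel (f 0) (+ n * δ) ⟩
    f 0 + + n * δ - f 0    ≡⟨ cong (_- f 0) (trans (sym (progression n)) fn≡f0) ⟩
    f 0 - f 0              ≡⟨ +-inverseʳ (f 0) ⟩
    0ℤ                     ∎
    where
    cancel : ∀ x y → y ≡ x + y - x
    cancel = solve-∀

  δ≡0 : δ ≡ 0ℤ
  δ≡0 = [ (λ ()) , id ]′ (i*j≡0⇒i≡0∨j≡0 (+ n) nδ≡0)

-- Alternating signs.

alt : ℕ → ℤ
alt zero    = 1ℤ
alt (suc k) = - alt k

alt-±1 : ∀ k → alt k ≡ 1ℤ ⊎ alt k ≡ -1ℤ
alt-±1 zero    = inj₁ refl
alt-±1 (suc k) = swap (map (cong (λ e → - e)) (cong (λ e → - e)) (alt-±1 k))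

alt-square : ∀ k → alt k * alt k ≡ 1ℤ
alt-square k = [ (λ e → cong₂ _*_ e e) , (λ e → cong₂ _*_ e e) ]′ (alt-±1 k)

alt-+ : ∀ k l → alt (k ℕ.+ l) ≡ alt k * alt l
alt-+ zero    l = sym (*-identityˡ (alt l))
alt-+ (suc k) l = trans (cong (λ e → - e) (alt-+ k l)) (neg-distribˡ-* (alt k) (alt l))

alt-even : ∀ q → alt (q ℕ.* 2) ≡ 1ℤ
alt-even zero    = refl
alt-even (suc q) = trans (neg-involutive (alt (q ℕ.* 2))) (alt-even q)

-- The cycle matrix and its eigenvalue -2.

module CycleMatrix {n} .{{_ : ℕ.NonZero n}} (B : Mat n) (3≤n : 3 ≤ n) (v : Fin n → Fin n)
  (v-injective : Injective _≡_ _≡_ v)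
  (spec : ∀ a b → ((CycSucc a b ⊎ CycSucc b a) × B (v a) (v b) ≡ + 1)
                ⊎ (¬ (CycSucc a b ⊎ CycSucc b a) × B (v a) (v b) ≡ + 0))
  where

  -- Indexing the cycle periodically by all naturals makes `V k` and `V (2 + k)` the neighbours of
  -- `V (suc k)`, with no special case at the closing edge.
  V : ℕ → Fin n
  V k = v (k mod n)

  index : Fin n → Fin n
  index j = proj₁ (injective⇒surjective v v-injective j)

  v-index : ∀ j → v (index j) ≡ j
  v-index j = proj₂ (injective⇒surjective v v-injective j)

  index-v : ∀ a → index (v a) ≡ a
  index-v a = v-injective (v-index (v a))

  V-periodic : ∀ k → V (k ℕ.+ n) ≡ V k
  V-periodic k = cong v (toℕ-injective (begin
    toℕ ((k ℕ.+ n) mod n)   ≡⟨ toℕ-mod (k ℕ.+ n) n ⟩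
    (k ℕ.+ n) % n           ≡⟨ [m+n]%n≡m%n k n ⟩
    k % n                   ≡⟨ toℕ-mod k n ⟨
    toℕ (k mod n)           ∎))

  V-index : ∀ j → V (toℕ (index j)) ≡ j
  V-index j = trans (cong v (toℕ-mod-id (index j))) (v-index j)

  -- `B-*V` describes `B` only at vertices of the form `V (suc k)`. Going once more round the cycle
  -- gives every vertex, `V 0` included, a positive index.
  V-surjective⁺ : ∀ j → ∃[ k ] V (suc k) ≡ j
  V-surjective⁺ j = toℕ (index j) ℕ.+ ℕ.pred n , (begin
    V (suc (toℕ (index j) ℕ.+ ℕ.pred n))   ≡⟨ cong V (ℕ.+-suc (toℕ (index j)) (ℕ.pred n)) ⟨
    V (toℕ (index j) ℕ.+ suc (ℕ.pred n))   ≡⟨ cong (λ m → V (toℕ (index j) ℕ.+ m)) (ℕ.suc-pred n) ⟩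
    V (toℕ (index j) ℕ.+ n)                ≡⟨ V-periodic (toℕ (index j)) ⟩
    V (toℕ (index j))                      ≡⟨ V-index j ⟩
    j                                      ∎)

  B-adjacent : ∀ a b → CycSucc a b ⊎ CycSucc b a → B (v a) (v b) ≡ 1ℤ
  B-adjacent a b ab with spec a b
  ... | inj₁ (_   , eq) = eq
  ... | inj₂ (¬ab , _ ) = contradiction ab ¬ab

  B-*V : ∀ x k → (B *V x) (V (suc k)) ≡ x (V k) + x (V (2 ℕ.+ k))
  B-*V x k = begin
    (B *V x) (V (suc k))
      ≡⟨ sum-pair _ prev≢next elsewhere ⟩
    B (V (suc k)) (V k) * x (V k) + B (V (suc k)) (V (2 ℕ.+ k)) * x (V (2 ℕ.+ k))
      ≡⟨ cong₂ (λ b c → b * x (V k) + c * x (V (2 ℕ.+ k)))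
               (B-adjacent _ _ (inj₂ prev)) (B-adjacent _ _ (inj₁ next)) ⟩
    1ℤ * x (V k) + 1ℤ * x (V (2 ℕ.+ k))
      ≡⟨ cong₂ _+_ (*-identityˡ (x (V k))) (*-identityˡ (x (V (2 ℕ.+ k)))) ⟩
    x (V k) + x (V (2 ℕ.+ k)) ∎
    where
    prev : CycSucc (k mod n) (suc k mod n)
    prev = CycSucc-mod k n

    next : CycSucc (suc k mod n) ((2 ℕ.+ k) mod n)
    next = CycSucc-mod (suc k) n

    prev≢next : V k ≢ V (2 ℕ.+ k)
    prev≢next eq = CycSucc-asym 3≤n prev
      (subst (CycSucc (suc k mod n)) (sym (v-injective eq)) next)

    elsewhere : ∀ j → j ≢ V k → j ≢ V (2 ℕ.+ k) → B (V (suc k)) j * x j ≡ 0ℤ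
    -- A neighbour of `V (suc k)` is its unique successor or its unique predecessor, both of which
    -- are excluded here, so the entry of `B` is 0.
    elsewhere j j≢prev j≢next with spec (suc k mod n) (index j)
    ... | inj₁ (inj₁ s , _) =
      contradiction (trans (sym (v-index j)) (cong v (CycSucc-functional s next))) j≢next
    ... | inj₁ (inj₂ s , _) =
      contradiction (trans (sym (v-index j)) (cong v (CycSucc-injective s prev))) j≢prev
    ... | inj₂ (_ , Bij≡0)  = begin
      B (V (suc k)) j * x j              ≡⟨ cong (λ i → B (V (suc k)) i * x j) (v-index j) ⟨
      B (V (suc k)) (v (index j)) * x j  ≡⟨ cong (_* x j) Bij≡0 ⟩
      0ℤ * x j                           ≡⟨ *-zeroˡ (x j) ⟩
      0ℤ                                 ∎

  B-𝟙 : ∀ i → (B *V 𝟙) i ≡ + 2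
  B-𝟙 i with V-surjective⁺ i
  ... | k , refl = B-*V 𝟙 k

  alternating : Vector ℤ n
  alternating j = alt (toℕ (index j))

  module EvenOrder (q : ℕ) (n≡q*2 : n ≡ q ℕ.* 2) where

    -- `k` and its residue differ by a multiple of `n`. As `n` is even this leaves the sign
    -- unchanged, so the signs also alternate across the closing edge.
    alternating-V : ∀ k → alternating (V k) ≡ alt k
    alternating-V k = begin
      alt (toℕ (index (V k)))               ≡⟨ cong (alt ∘ toℕ) (index-v (k mod n)) ⟩
      alt (toℕ (k mod n))                   ≡⟨ cong alt (toℕ-mod k n) ⟩
      alt (k % n)                           ≡⟨ *-identityʳ (alt (k % n)) ⟨
      alt (k % n) * 1ℤ                      ≡⟨ cong (alt (k % n) *_) (alt-even (k / n ℕ.* q)) ⟨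
      alt (k % n) * alt (k / n ℕ.* q ℕ.* 2) ≡⟨ alt-+ (k % n) _ ⟨
      alt (k % n ℕ.+ k / n ℕ.* q ℕ.* 2)     ≡⟨ cong (λ m → alt (k % n ℕ.+ m)) (ℕ.*-assoc (k / n) q 2) ⟩
      alt (k % n ℕ.+ k / n ℕ.* (q ℕ.* 2))   ≡⟨ cong (λ m → alt (k % n ℕ.+ k / n ℕ.* m)) n≡q*2 ⟨
      alt (k % n ℕ.+ k / n ℕ.* n)           ≡⟨ cong alt (m≡m%n+[m/n]*n k n) ⟨
      alt k                                 ∎

    B-alternating : ∀ i → (B *V alternating) i ≡ - + 2 * alternating i
    B-alternating i with V-surjective⁺ i
    ... | k , refl = begin
      (B *V alternating) (V (suc k))                  ≡⟨ B-*V alternating k ⟩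
      alternating (V k) + alternating (V (2 ℕ.+ k))   ≡⟨ cong₂ _+_ (alternating-V k) (alternating-V (2 ℕ.+ k)) ⟩
      alt k + - - alt k                               ≡⟨ double (alt k) ⟩
      - + 2 * - alt k                                 ≡⟨ cong (- + 2 *_) (alternating-V (suc k)) ⟨
      - + 2 * alternating (V (suc k))                 ∎
      where
      double : ∀ e → e + - - e ≡ - + 2 * - e
      double = solve-∀

    -- Twisting `w` by the alternating signs turns the eigenvalue equation into the midpoint
    -- equation for `s`. Because `n` is even, `s` returns to its initial value after one turn, hence
    -- is constant, and untwisting gives a multiple of `alternating`.
    -2-eigenspace : ∀ w → (∀ i → (B *V w) i ≡ - + 2 * w i) → ∀ i → w i ≡ w (V 0) * alternating i
    -2-eigenspace w Bw≡-2w i = begin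
      w i                     ≡⟨ cong w (V-index i) ⟨
      w (V k)                 ≡⟨ *-identityˡ (w (V k)) ⟨
      1ℤ * w (V k)            ≡⟨ cong (_* w (V k)) (alt-square k) ⟨
      alt k * alt k * w (V k) ≡⟨ *-assoc (alt k) (alt k) (w (V k)) ⟩
      alt k * s k             ≡⟨ cong (alt k *_) (midpoint-closed⇒constant s midpoint n closed k) ⟩
      alt k * s 0             ≡⟨ *-comm (alt k) (s 0) ⟩
      s 0 * alt k             ≡⟨ cong (_* alt k) (*-identityˡ (w (V 0))) ⟩
      w (V 0) * alt k         ∎
      where
      k = toℕ (index i)

      s : ℕ → ℤ
      s l = alt l * w (V l)

      midpoint : ∀ l → s l + s (2 ℕ.+ l) ≡ + 2 * s (1 ℕ.+ l)
      midpoint l = begin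
        s l + s (2 ℕ.+ l)                       ≡⟨ factor (alt l) (w (V l)) (w (V (2 ℕ.+ l))) ⟩
        alt l * (w (V l) + w (V (2 ℕ.+ l)))     ≡⟨ cong (alt l *_) (trans (sym (B-*V w l)) (Bw≡-2w (V (suc l)))) ⟩
        alt l * (- + 2 * w (V (suc l)))         ≡⟨ transfer (alt l) (w (V (suc l))) ⟩
        + 2 * s (1 ℕ.+ l)                       ∎
        where
        factor : ∀ a x z → a * x + - - a * z ≡ a * (x + z)
        factor = solve-∀
        transfer : ∀ a y → a * (- + 2 * y) ≡ + 2 * (- a * y)
        transfer = solve-∀

      closed : s n ≡ s 0
      closed = cong₂ _*_ (trans (cong alt n≡q*2) (alt-even q)) (cong w (V-periodic 0))

-- Row and column sums of an adjacency matrix.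

sum-indicator : (b : Fin n → Bool) →
  sum (λ j → if b j then + 1 else + 0) ≡ + sumℕ (λ j → if b j then 1 else 0)
sum-indicator {zero}  b = refl
sum-indicator {suc n} b with b zero
... | true  = cong (_+_ 1ℤ) (sum-indicator (b ∘ suc))
... | false = trans (+-identityˡ _) (sum-indicator (b ∘ suc))

-- `q` counts the selected entries equal to -1; each of them lowers the sum by two compared with an
-- entry 1.
signed-sum : (b : Fin n → Bool) (x : Vector ℤ n) → (∀ j → x j ≡ 1ℤ ⊎ x j ≡ -1ℤ) →
  let S = sumℕ (λ j → if b j then 1 else 0) in
  ∃[ q ] (q ≤ S × sum (λ j → (if b j then + 1 else + 0) * x j) ≡ + S - + 2 * + q)
signed-sum {zero}  b x x±1 = 0 , z≤n , refl
signed-sum {suc n} b x x±1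
  with q , q≤S , eq ← signed-sum (b ∘ suc) (x ∘ suc) (x±1 ∘ suc) | b zero | x zero | x±1 zero
... | true  | _ | inj₁ refl = q , ℕ.m≤n⇒m≤1+n q≤S ,
  trans (cong (_+_ 1ℤ) eq) (sym (+-assoc 1ℤ (+ S′) (- (+ 2 * + q))))
  where S′ = sumℕ (λ j → if b (suc j) then 1 else 0)
... | true  | _ | inj₂ refl = suc q , s≤s q≤S ,
  trans (cong (_+_ -1ℤ) eq) (flip (+ sumℕ (λ j → if b (suc j) then 1 else 0)) (+ q))
  where
  flip : ∀ s r → -1ℤ + (s - + 2 * r) ≡ 1ℤ + s - + 2 * (1ℤ + r)
  flip = solve-∀
... | false | y | _         = q , q≤S ,
  trans (cong₂ _+_ (*-zeroˡ y) eq) (+-identityˡ _)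

adjMatrix-row-sum : ∀ {d} (Γ : Graph n) → Regular d Γ → ∀ i → sum (adjMatrix Γ i) ≡ + d
adjMatrix-row-sum Γ reg i = trans (sum-indicator (adj Γ i)) (cong +_ (reg i))

adjMatrix-𝟙 : ∀ {d} (Γ : Graph n) → Regular d Γ → ∀ i → (adjMatrix Γ *V 𝟙) i ≡ + d * 1ℤ
adjMatrix-𝟙 {d = d} Γ reg i = begin
  sum (λ j → adjMatrix Γ i j * 1ℤ)   ≡⟨ sum-cong-≗ (λ j → *-identityʳ (adjMatrix Γ i j)) ⟩
  sum (adjMatrix Γ i)                ≡⟨ adjMatrix-row-sum Γ reg i ⟩
  + d                                ≡⟨ *-identityʳ (+ d) ⟨
  + d * 1ℤ                           ∎

-- After exchanging the sums, column sums of `A` appear, and by symmetry they equal the row sums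
-- `d`. This is the identity JA = dJ on vectors.
sum-adjMatrix-*V : ∀ {d} (Γ : Graph n) → Regular d Γ → ∀ x → sum (adjMatrix Γ *V x) ≡ + d * sum x
sum-adjMatrix-*V {d = d} Γ reg x = begin
  sum (λ i → sum (λ j → A i j * x j))   ≡⟨ ∑-comm (λ i j → A i j * x j) ⟩
  sum (λ j → sum (λ i → A i j * x j))   ≡⟨ sum-cong-≗ column ⟩
  sum (λ j → + d * x j)                 ≡⟨ *-distribˡ-sum (+ d) x ⟨
  + d * sum x                           ∎
  where
  A = adjMatrix Γ
  column : ∀ j → sum (λ i → A i j * x j) ≡ + d * x j
  column j = begin
    sum (λ i → A i j * x j)   ≡⟨ sum-cong-≗ (λ i → cong (λ e → (if e then + 1 else + 0) * x j) (adj-sym Γ i j)) ⟩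
    sum (λ i → A j i * x j)   ≡⟨ *-distribʳ-sum (x j) (A j) ⟨
    sum (A j) * x j           ≡⟨ cong (_* x j) (adjMatrix-row-sum Γ reg j) ⟩
    + d * x j                 ∎

-- At index 1 the value is d + 1, which is even. In the recurrence, the first term is even by
-- induction and the second has the even factor d - 1. Index 0 must be left out, since the value
-- there is 1.
G-even-at-degree : ∀ {d} → Odd d → ∀ m → + 2 Signed.∣ evalP (G d (suc m)) (+ d)
G-even-at-degree {d} (k , refl) zero = divides (1ℤ + + k) (begin
  1ℤ + (1ℤ + + (2 ℕ.* k)) * (1ℤ + (1ℤ + + (2 ℕ.* k)) * 0ℤ)
    ≡⟨ cong (λ e → 1ℤ + (1ℤ + e) * (1ℤ + (1ℤ + e) * 0ℤ)) (pos-* 2 k) ⟩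
  1ℤ + (1ℤ + + 2 * + k) * (1ℤ + (1ℤ + + 2 * + k) * 0ℤ)
    ≡⟨ double (+ k) ⟩
  (1ℤ + + k) * + 2 ∎)
  where
  double : ∀ c → 1ℤ + (1ℤ + + 2 * c) * (1ℤ + (1ℤ + + 2 * c) * 0ℤ) ≡ (1ℤ + c) * + 2
  double = solve-∀
G-even-at-degree {d} odd@(k , refl) (suc m) = subst (+ 2 Signed.∣_) (sym (evalP-G d m (+ d)))
  (Signed.∣m∣n⇒∣m-n (Signed.∣n⇒∣m*n (+ d) (G-even-at-degree odd m))
                    (Signed.∣m⇒∣m*n (evalP (G d m) (+ d)) 2∣2k))
  where
  2∣2k : + 2 Signed.∣ + (2 ℕ.* k)
  2∣2k = divides (+ k) (trans (pos-* 2 k) (*-comm (+ 2) (+ k)))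

-- The equation G(A) = J + σB acting on vectors.

±1-cancelˡ : ∀ {σ x y} → σ ≡ 1ℤ ⊎ σ ≡ -1ℤ → σ * x ≡ σ * y → x ≡ y
±1-cancelˡ {σ} {x} {y} (inj₁ refl) = *-cancelˡ-≡ 1ℤ x y
±1-cancelˡ {σ} {x} {y} (inj₂ refl) = *-cancelˡ-≡ -1ℤ x y

-- σ = 1 is the case of cyclic defect, σ = -1 that of cyclic excess.
module CyclicEquation {n d m : ℕ} (Γ : Graph n) (reg : Regular d Γ)
  {B : Mat n} (σ : ℤ) (σ±1 : σ ≡ 1ℤ ⊎ σ ≡ -1ℤ)
  (equation : ∀ i j → evalMat (G d m) (adjMatrix Γ) i j ≡ 1ℤ + σ * B i j)
  where

  A : Mat n
  A = adjMatrix Γ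

  evalMat-*V : ∀ x i → (evalMat (G d m) A *V x) i ≡ σ * (B *V x) i + sum x
  evalMat-*V x i = begin
    sum (λ j → evalMat (G d m) A i j * x j)
      ≡⟨ sum-cong-≗ (λ j → trans (cong (_* x j) (equation i j)) (expand σ (B i j) (x j))) ⟩
    sum (λ j → σ * (B i j * x j) + x j)
      ≡⟨ ∑-distrib-+ (λ j → σ * (B i j * x j)) x ⟩
    sum (λ j → σ * (B i j * x j)) + sum x
      ≡⟨ cong (_+ sum x) (*-distribˡ-sum σ (λ j → B i j * x j)) ⟨
    σ * (B *V x) i + sum x ∎
    where
    expand : ∀ s b y → (1ℤ + s * b) * y ≡ s * (b * y) + y
    expand = solve-∀

  -- A commutes with G(A), and with J by regularity, hence with B.
  B-eigenspace-invariant : ∀ x c → (∀ i → (B *V x) i ≡ c * x i) →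
                           ∀ i → (B *V A *V x) i ≡ c * (A *V x) i
  B-eigenspace-invariant x c Bx≡cx i = ±1-cancelˡ σ±1 (∙-cancelʳ (+ d * sum x) _ _ (begin
    σ * (B *V A *V x) i + + d * sum x
      ≡⟨ cong (_+_ (σ * (B *V A *V x) i)) (sum-adjMatrix-*V Γ reg x) ⟨
    σ * (B *V A *V x) i + sum (A *V x)
      ≡⟨ evalMat-*V (A *V x) i ⟨
    (evalMat (G d m) A *V A *V x) i
      ≡⟨ evalMat-comm (G d m) A x i ⟩
    (A *V evalMat (G d m) A *V x) i
      ≡⟨ *V-cong A (λ j → trans (evalMat-*V x j) (scaled (Bx≡cx j))) i ⟩
    (A *V (λ j → σ * c * x j + sum x * 𝟙 j)) i
      ≡⟨ *V-+ A (λ j → σ * c * x j) (λ j → sum x * 𝟙 j) i ⟩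
    (A *V (λ j → σ * c * x j)) i + (A *V (λ j → sum x * 𝟙 j)) i
      ≡⟨ cong₂ _+_ (*V-scale A (σ * c) x i) (*V-scale A (sum x) 𝟙 i) ⟩
    σ * c * (A *V x) i + sum x * (A *V 𝟙) i
      ≡⟨ cong (λ e → σ * c * (A *V x) i + sum x * e) (adjMatrix-𝟙 Γ reg i) ⟩
    σ * c * (A *V x) i + sum x * (+ d * 1ℤ)
      ≡⟨ reorder σ c ((A *V x) i) (sum x) (+ d) ⟩
    σ * (c * (A *V x) i) + + d * sum x ∎))
    where
    scaled : ∀ {y b} → b ≡ c * y → σ * b + sum x ≡ σ * c * y + sum x * 1ℤ
    scaled {y} b≡cy = cong₂ _+_ (trans (cong (σ *_) b≡cy) (sym (*-assoc σ c y))) (sym (*-identityʳ (sum x)))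
    reorder : ∀ s c y t e → s * c * y + t * (e * 1ℤ) ≡ s * (c * y) + e * t
    reorder = solve-∀

  -- Parity of the order and the eigenvalue of the alternating vector.

  module _ (odd : Odd d) (1≤m : 1 ≤ m) (3≤n : 3 ≤ n) (v : Fin n → Fin n)
    (v-injective : Injective _≡_ _≡_ v)
    (spec : ∀ a b → ((CycSucc a b ⊎ CycSucc b a) × B (v a) (v b) ≡ + 1)
                  ⊎ (¬ (CycSucc a b ⊎ CycSucc b a) × B (v a) (v b) ≡ + 0))
    where

    private instance
      n≢0 : ℕ.NonZero n
      n≢0 = ℕ.>-nonZero (ℕ.≤-trans (s≤s z≤n) 3≤n)

    open CycleMatrix B 3≤n v v-injective spec

    -- The all-ones vector is an eigenvector of `A`, `B` and J, with eigenvalues d, 2 and n. The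
    -- parity of `n` is read off from the resulting equation.
    G-at-degree : evalP (G d m) (+ d) ≡ σ * + 2 + + n
    G-at-degree = begin
      evalP (G d m) (+ d)                  ≡⟨ *-identityʳ _ ⟨
      evalP (G d m) (+ d) * 1ℤ             ≡⟨ evalMat-eigen (G d m) A 𝟙 (+ d) (adjMatrix-𝟙 Γ reg) (V 0) ⟨
      (evalMat (G d m) A *V 𝟙) (V 0)       ≡⟨ evalMat-*V 𝟙 (V 0) ⟩
      σ * (B *V 𝟙) (V 0) + sum {n} 𝟙       ≡⟨ cong₂ (λ b s → σ * b + s) (B-𝟙 (V 0)) (trans (sum-const n 1ℤ) (*-identityʳ (+ n))) ⟩
      σ * + 2 + + n                        ∎

    order-even : 2 ∣ n
    order-even = ∣⇒∣ᵤ (Signed.∣m+n∣m⇒∣n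
      (subst (+ 2 Signed.∣_) G-at-degree (even m 1≤m)) (divides σ refl))
      where
      even : ∀ m → 1 ≤ m → + 2 Signed.∣ evalP (G d m) (+ d)
      even (suc m) _ = G-even-at-degree odd m

    open EvenOrder (quotient order-even) (m∣n⇒n≡quotient*m order-even)

    -- `alternating` has the entry 1 at `V 0`, so the eigenvalue is simply the entry of the image
    -- there, visibly an integer.
    θ : ℤ
    θ = (A *V alternating) (V 0)

    A-alternating : ∀ i → (A *V alternating) i ≡ θ * alternating i
    A-alternating = -2-eigenspace (A *V alternating) (B-eigenspace-invariant alternating (- + 2) B-alternating)

    -- The contribution `S` of J is the same at every vertex, whereas the signs at `V 0` and `V 1`
    -- are opposite. Subtracting the equations at these two vertices eliminates `S` without
    -- computing it, and leaves twice the claim.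
    G-at-θ : evalP (G d m) θ ≡ σ * - + 2
    G-at-θ = *-cancelˡ-≡ (+ 2) _ _ (begin
      + 2 * P                          ≡⟨ antisymmetrise P ⟩
      P * 1ℤ - P * -1ℤ                 ≡⟨ cong₂ _-_ (at 0) (at 1) ⟩
      (σ * (- + 2 * 1ℤ) + S) - (σ * (- + 2 * -1ℤ) + S)   ≡⟨ combine σ S ⟩
      + 2 * (σ * - + 2)                ∎)
      where
      P = evalP (G d m) θ
      S = sum alternating
      at : ∀ k → P * alt k ≡ σ * (- + 2 * alt k) + S
      at k = begin
        P * alt k                                        ≡⟨ cong (P *_) (alternating-V k) ⟨
        P * alternating (V k)                            ≡⟨ evalMat-eigen (G d m) A alternating θ A-alternating (V k) ⟨
        (evalMat (G d m) A *V alternating) (V k)         ≡⟨ evalMat-*V alternating (V k) ⟩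
        σ * (B *V alternating) (V k) + S                 ≡⟨ cong (λ b → σ * b + S) (B-alternating (V k)) ⟩
        σ * (- + 2 * alternating (V k)) + S              ≡⟨ cong (λ a → σ * (- + 2 * a) + S) (alternating-V k) ⟩
        σ * (- + 2 * alt k) + S                          ∎
      antisymmetrise : ∀ p → + 2 * p ≡ p * 1ℤ - p * -1ℤ
      antisymmetrise = solve-∀
      combine : ∀ s t → (s * (- + 2 * 1ℤ) + t) - (s * (- + 2 * -1ℤ) + t) ≡ + 2 * (s * - + 2)
      combine = solve-∀

    -- `θ` is a sum of signs over the neighbours of `V 0`, so `signed-sum` brings it into the form d
    -- - 2q. The absolute value lets a single check serve both values of `σ`.
    ∣G∣≡2-at-root : ∃[ q ] (q ≤ d × ∣ evalP (G d m) (+ d - + 2 * + q) ∣ ≡ 2)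
    ∣G∣≡2-at-root with signed-sum (adj Γ (V 0)) alternating (λ j → alt-±1 (toℕ (index j)))
    ... | q , q≤S , θ≡ = q , subst (q ≤_) (reg (V 0)) q≤S , (begin
      ∣ evalP (G d m) (+ d - + 2 * + q) ∣   ≡⟨ cong (λ e → ∣ evalP (G d m) (+ e - + 2 * + q) ∣) (reg (V 0)) ⟨
      ∣ evalP (G d m) (+ degree Γ (V 0) - + 2 * + q) ∣   ≡⟨ cong (λ e → ∣ evalP (G d m) e ∣) θ≡ ⟨
      ∣ evalP (G d m) θ ∣                   ≡⟨ cong ∣_∣ G-at-θ ⟩
      ∣ σ * - + 2 ∣                         ≡⟨ [ cong ∣_*-2∣ , cong ∣_*-2∣ ]′ σ±1 ⟩
      2                                     ∎)
      where
      ∣_*-2∣ : ℤ → ℕ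
      ∣ s *-2∣ = ∣ s * - + 2 ∣

-- Screening the values of the recurrence by computation.

-- The state holds two consecutive terms, so `k` terms cost a linear number of steps; unfolding `G`
-- itself would branch twice at each index.
avoids±2 : (c e : ℤ) → ℕ → ℤ → ℤ → Bool
avoids±2 c e zero    x y = true
avoids±2 c e (suc k) x y = not (∣ x ∣ ℕ.≡ᵇ 2) ∧ avoids±2 c e k y (c * y - e * x)

avoids±2-sound : ∀ c e (f : ℕ → ℤ) → (∀ m → f (2 ℕ.+ m) ≡ c * f (1 ℕ.+ m) - e * f m) →
                 ∀ k l → avoids±2 c e k (f l) (f (suc l)) ≡ true → ∀ {i} → i ℕ.< k → ∣ f (i ℕ.+ l) ∣ ≢ 2
avoids±2-sound c e f rec (suc k) l ok {zero} _ ∣f∣≡2 with ∣ f l ∣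
-- Once the absolute value is 2, the first conjunct of the check is false, so `ok` is absurd.
avoids±2-sound c e f rec (suc k) l () {zero} _ refl | _
avoids±2-sound c e f rec (suc k) l ok {suc i} (s≤s i<k) =
  subst (λ j → ∣ f j ∣ ≢ 2) (ℕ.+-suc i l)
    (avoids±2-sound c e f rec k (suc l)
      (subst (λ z → avoids±2 c e k (f (suc l)) z ≡ true) (sym (rec l)) (∧-conicalʳ _ _ ok)) i<k)

-- The run starts at index 3, just past the genuine solution at index 2 with θ = 3; the factor 10 is
-- d - 1.
screen₁₁ : ℕ → ℕ → Bool
screen₁₁ k q = avoids±2 θ (+ 10) k (evalP (G 11 3) θ) (evalP (G 11 4) θ)
  where θ = + 11 - + 2 * + q

-- Stated for a variable k: with the numeral in its place, conversion checking unfolds the screen.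
screen₁₁-sound : ∀ k → all (screen₁₁ k) (upTo 12) ≡ true →
                 ∀ {m q} → 3 ≤ m → m ℕ.< k ℕ.+ 3 → q ≤ 11 → ∣ evalP (G 11 m) (+ 11 - + 2 * + q) ∣ ≢ 2
screen₁₁-sound k ok {m} {q} 3≤m m<k+3 q≤11 =
  subst (λ j → ∣ evalP (G 11 j) θ ∣ ≢ 2) (ℕ.m∸n+n≡m 3≤m)
    (avoids±2-sound θ (+ 10) (λ j → evalP (G 11 j) θ) (λ j → evalP-G 11 j θ) k 3
      passes-q
      (ℕ.+-cancelʳ-< 3 (m ∸ 3) k (subst (ℕ._< k ℕ.+ 3) (sym (ℕ.m∸n+n≡m 3≤m)) m<k+3)))
  where
  θ = + 11 - + 2 * + q

  passes-q : screen₁₁ k q ≡ true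
  passes-q = Equivalence.to T-≡
    (All.lookup (all⁺ (screen₁₁ k) (upTo 12) (Equivalence.from T-≡ ok)) (∈-upTo⁺ (s≤s q≤11)))

-- Evaluated by the type checker: 19998 terms from index 3 on cover the indices 3 to 20000, for each
-- of the twelve values of `q`.
screen₁₁-passes : all (screen₁₁ 19998) (upTo 12) ≡ true
screen₁₁-passes = refl

-- Excluding cyclic defect and cyclic excess.

no-solution : ∀ {n m} (Γ : Graph n) {B : Mat n} σ → σ ≡ 1ℤ ⊎ σ ≡ -1ℤ → Regular 11 Γ → IsCycleMatrix B →
  3 ≤ m → m ≤ 20000 → ¬ (∀ i j → evalMat (G 11 m) (adjMatrix Γ) i j ≡ 1ℤ + σ * B i j)
no-solution {m = m} Γ σ σ±1 reg (3≤n , v , v-injective , spec) 3≤m m≤20000 equation =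
  -- The witness 5 shows that 11 = 2 * 5 + 1 is odd.
  let q , q≤11 , ∣G∣≡2 = ∣G∣≡2-at-root (5 , refl) (ℕ.≤-trans (s≤s z≤n) 3≤m) 3≤n v v-injective spec
  in screen₁₁-sound 19998 screen₁₁-passes 3≤m (s≤s m≤20000) q≤11 ∣G∣≡2
  where open CyclicEquation {m = m} Γ reg σ σ±1 equation

theorem9 : ((n : ℕ) (Γ : Graph n) (D : ℕ) → 3 ≤ D → D ≤ 20000 → ¬ CyclicDefect 11 D Γ)
    × ((n : ℕ) (Γ : Graph n) (g : ℕ) → Odd g → 7 ≤ g → g ≤ 40001 → ¬ CyclicExcess 11 g Γ)
theorem9 = defect , excess
  where
  defect : (n : ℕ) (Γ : Graph n) (D : ℕ) → 3 ≤ D → D ≤ 20000 → ¬ CyclicDefect 11 D Γ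
  defect n Γ D 3≤D D≤20000 (reg , _ , _ , _ , B , cycle , G≐J+B) =
    no-solution Γ {B} 1ℤ (inj₁ refl) reg cycle 3≤D D≤20000 λ i j →
      trans (G≐J+B i j) (cong (_+_ 1ℤ) (sym (*-identityˡ (B i j))))

  excess : (n : ℕ) (Γ : Graph n) (g : ℕ) → Odd g → 7 ≤ g → g ≤ 40001 → ¬ CyclicExcess 11 g Γ
  excess n Γ g _ 7≤g g≤40001 (reg , _ , _ , _ , _ , B , cycle , G≐J-B) =
    -- Halving the bounds 7 and 40001 on the girth, rounded down, gives exactly 3 and 20000.
    no-solution Γ {B} -1ℤ (inj₂ refl) reg cycle (ℕ.⌊n/2⌋-mono 7≤g) (ℕ.⌊n/2⌋-mono g≤40001) λ i j →
      trans (G≐J-B i j) (cong (_+_ 1ℤ) (sym (-1*i≡-i (B i j))))
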